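{- Let $R$ be a finite commutative chain ring with maximal ideal $\mathfrak{m}$, residue field $R/\mathfrak{m}\cong\mathbb{F}_q$, and nilpotency index $\nu$ of $\mathfrak{m}$ (so $|R|=q^\nu$, $|\mathfrak{m}|=q^{\nu-1}$). Then the uniform matroid $U_{2,n}$ is representable over $R$ if and only if $n\le q^\nu+q^{\nu-1}$. In particular, neither $U_{2,q^\nu+q^{\nu-1}+1}$ nor $U_{q^\nu+q^{\nu-1}-1,\,q^\nu+q^{\nu-1}+1}$ is representable over $R$.
   Context: For a local ring $R$ with maximal ideal $\mathfrak{m}$, vectors $v_1,\dots,v_\ell$ of an $R$-module are modular independent if $\sum\alpha_iv_i=0$ implies all $\alpha_i\in\mathfrak{m}$. For a finite set $E$, an $R$-module $V$ and a map $A\colon E\to V$, $M[A]$ is the independence system on $E$ whose independent sets are the $I\subseteq E$ with $(A(i))_{i\in I}$ modular independent. A matroid $M$ is representable over $R$ if $M$ is isomorphic to $M[A]$ for some finite set $E$ with $|E|=|E(M)|$, some $R$-module $V$ and some $A\colon E\to V$. $U_{k,n}$ denotes the uniform matroid of rank $k$ on $n$ elements. -}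

module Defs where

open import Level using (Level; _⊔_) renaming (zero to lzero)
open import Data.Nat using (ℕ; zero; suc; _<_; _≤_)
open import Data.Fin using (Fin; zero; suc)
open import Data.Fin.Subset using (Subset; _∈_; ∣_∣)
open import Data.Vec using (tabulate; lookup)
open import Data.Bool using (if_then_else_)
open import Data.Product using (Σ; _×_; ∃)
open import Data.Sum using (_⊎_)
open import Data.Empty using (⊥)
open import Relation.Nullary using (¬_)
open import Relation.Binary.PropositionalEquality using (_≡_)
open import Function.Bundles using (_↔_; Inverse; _⇔_)
open import Algebra.Bundles using (CommutativeRing)
open import Algebra.Module.Bundles using (Module)

IndepSystem : ∀ p → ℕ → Set (Level.suc p)
IndepSystem p n = Subset n → Set p

U : (k n : ℕ) → IndepSystem lzero n
U k n I = ∣ I ∣ ≤ k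

image : ∀ {n} → (Fin n ↔ Fin n) → Subset n → Subset n
image σ I = tabulate (λ j → lookup I (Inverse.from σ j))

Isomorphic : ∀ {p p' n} → IndepSystem p n → IndepSystem p' n → Set (p ⊔ p')
Isomorphic {n = n} M M' =
  Σ (Fin n ↔ Fin n) λ σ → ∀ I → M I ⇔ M' (image σ I)

module _ {c ℓ} (R : CommutativeRing c ℓ) where
  open CommutativeRing R hiding (zero)

  sumR : ∀ {n} → (Fin n → Carrier) → Carrier
  sumR {zero}  f = 0#
  sumR {suc n} f = f zero + sumR (λ i → f (suc i))

  prodR : ∀ {n} → (Fin n → Carrier) → Carrier
  prodR {zero}  f = 1#
  prodR {suc n} f = f zero * prodR (λ i → f (suc i))

  PredR : Set (Level.suc (c ⊔ ℓ))
  PredR = Carrier → Set (c ⊔ ℓ)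

  _⊆R_ : PredR → PredR → Set (c ⊔ ℓ)
  I ⊆R J = ∀ x → I x → J x

  record IsIdeal (I : PredR) : Set (c ⊔ ℓ) where
    field
      resp  : ∀ {x y} → x ≈ y → I x → I y
      zero∈ : I 0#
      +-closed : ∀ {x y} → I x → I y → I (x + y)
      *-closed : ∀ r {x} → I x → I (r * x)

  Proper : PredR → Set (c ⊔ ℓ)
  Proper I = ¬ I 1#

  IsLocalWith : PredR → Set (Level.suc (c ⊔ ℓ))
  IsLocalWith m = IsIdeal m × Proper m × (∀ I → IsIdeal I → Proper I → I ⊆R m)

  IsChainRing : Set (Level.suc (c ⊔ ℓ))
  IsChainRing = ∀ I J → IsIdeal I → IsIdeal J → (I ⊆R J) ⊎ (J ⊆R I)

  IsFinite : Set (c ⊔ ℓ)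
  IsFinite = Σ ℕ λ N → Σ (Fin N → Carrier) λ e → ∀ x → ∃ λ i → e i ≈ x

  -- the residue field R/m has exactly q elements:
  -- q pairwise incongruent representatives covering all classes mod m
  ResidueCard : PredR → ℕ → Set (c ⊔ ℓ)
  ResidueCard m q = Σ (Fin q → Carrier) λ r →
      (∀ i j → m (r i - r j) → i ≡ j)
    × (∀ x → ∃ λ i → m (x - r i))

  ProdOf : PredR → ℕ → Carrier → Set (c ⊔ ℓ)
  ProdOf m k x = Σ (Fin k → Carrier) λ v → (∀ i → m (v i)) × x ≈ prodR v

  IdealPow : PredR → ℕ → PredR
  IdealPow m k x = Σ ℕ λ t → Σ (Fin t → Carrier) λ ys →
      (∀ j → ProdOf m k (ys j)) × x ≈ sumR ys

  IsZeroIdeal : PredR → Set (c ⊔ ℓ)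
  IsZeroIdeal I = ∀ x → I x → x ≈ 0#

  NilIndex : PredR → ℕ → Set (c ⊔ ℓ)
  NilIndex m ν = IsZeroIdeal (IdealPow m ν) × (∀ k → k < ν → ¬ IsZeroIdeal (IdealPow m k))

  module _ {a b} (V : Module R a b) where
    open Module V

    sumᴹ : ∀ {n} → (Fin n → Carrierᴹ) → Carrierᴹ
    sumᴹ {zero}  f = 0ᴹ
    sumᴹ {suc n} f = f zero +ᴹ sumᴹ (λ i → f (suc i))

    ModIndep : PredR → ∀ {n} → (Fin n → Carrierᴹ) → Subset n → Set (c ⊔ ℓ ⊔ b)
    ModIndep m A I = ∀ (α : _ → Carrier) →
      sumᴹ (λ i → if lookup I i then α i *ₗ A i else 0ᴹ) ≈ᴹ 0ᴹ →
      ∀ i → i ∈ I → m (α i)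

  MA : ∀ {a b} (V : Module R a b) → PredR → ∀ {n} → (Fin n → Module.Carrierᴹ V) →
       IndepSystem (c ⊔ ℓ ⊔ b) n
  MA V m A = ModIndep V m A

  Representable : PredR → (a b : Level) → ∀ {p n} → IndepSystem p n →
                  Set (c ⊔ ℓ ⊔ Level.suc (a ⊔ b) ⊔ p)
  Representable m a b {n = n} M =
    Σ (Module R a b) λ V → Σ (Fin n → Module.Carrierᴹ V) λ A → Isomorphic M (MA V m A)

{-# OPTIONS --safe #-}
module Submission where

-- Every vector of R² is a multiple of one of the q^ν + q^(ν-1) normalised vectors (1, t) and
-- (s, 1) with s ∈ m, and two multiples of the same vector are comparable because R is a chain
-- ring; so a family of pairwise non-proportional vectors of R² has at most q^ν + q^(ν-1) members.
--
-- A representation of U_{2,n} is spanned by two of its vectors (discard vectors occurring with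
-- a unit coefficient in a relation), and the coordinate vectors of all n vectors with respect to
-- these two are pairwise non-proportional. Conversely the normalised vectors represent U_{2,n}.
--
-- A representation of U_{n-2,n} has two relations r, s which are independent modulo m. If the
-- columns (r k, s k) and (r l, s l) were proportional, some unimodular combination of r and s
-- would vanish at k and l, contradicting the independence of the other n - 2 vectors. So these n
-- columns are again pairwise non-proportional vectors of R².

open import Defs
open import Level using (Level; _⊔_)
open import Data.Bool using (Bool; true; false; if_then_else_)
open import Data.Empty using (⊥; ⊥-elim)
open import Data.Fin using (Fin; zero; suc; combine; remQuot; splitAt; join; inject≤)
open import Data.Fin.Properties using (_≟_; any?; pigeonhole; combine-remQuot; remQuot-combine; join-splitAt; splitAt-join; <⇒≢; inject≤-injective; nonZeroIndex)
open import Data.Fin.Subset using (Subset; inside; outside; _∈_; _∉_; ∣_∣; _∪_; _-_; Nonempty; ⁅_⁆; ⊤)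
open import Data.Fin.Subset.Properties using (nonempty?; Empty-unique; ∣⊥∣≡0; p─q⊆p; x∈p∧x≢y⇒x∈p-y; x∈p⇒∣p-x∣<∣p∣; _∈?_; p⊆q⇒∣p∣≤∣q∣; ∣⁅x⁆∣≡1; x∈p∪q⁺; x∈⁅x⁆; ∈⊤; ∣⊤∣≡n; ∣p∣≤n)
open import Data.Nat using (ℕ; zero; suc; _+_; _∸_; _^_; _≤_; _<_; z≤n; s≤s; s≤s⁻¹; _≤?_; NonZero)
open import Data.Nat.Properties using (≤-trans; ≤-refl; ≤-reflexive; ≤-pred; m≤m+n; m∸n≤m; m+[n∸m]≡n; +-suc; +-monoʳ-≤; n≤1+n; ≰⇒>; <⇒≱; ≮⇒≥; m^n>0; ∸-monoˡ-≤; 1+n≰n; +-0-commutativeMonoid)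
open import Data.Product using (_×_; ∃; _,_; proj₁; proj₂)
open import Data.Sum using (_⊎_; inj₁; inj₂; [_,_]′; reduce)
open import Data.Vec using ([]; _∷_; tabulate; lookup; there)
open import Data.Vec.Properties using (tabulate-cong; tabulate∘lookup; lookup∘tabulate; []=⇒lookup; lookup⇒[]=)
open import Function using (_∘_)
open import Function.Bundles using (_↔_; Inverse; _⇔_; mk⇔; Equivalence)
open import Function.Properties.Inverse using (↔-sym; ↔-refl)
open import Relation.Nullary using (¬_; Dec; yes; no; does)
open import Relation.Nullary.Decidable using (decidable-stable)
open import Relation.Binary.PropositionalEquality as ≡ using (_≡_; _≢_)
open import Algebra.Bundles using (CommutativeMonoid; CommutativeRing)
open import Algebra.Module.Bundles using (Module)
import Algebra.Module.Construct.DirectProduct as Product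
import Algebra.Module.Construct.TensorUnit as TensorUnit
import Algebra.Module.Construct.Zero as Zero
import Algebra.Properties.CommutativeMonoid.Sum as Sum
import Algebra.Properties.CommutativeSemigroup
import Algebra.Properties.Ring
import Algebra.Properties.Semiring.Exp
import Algebra.Solver.Ring.NaturalCoefficients.Default
import Relation.Binary.Reasoning.Setoid

-- Finite subsets

private variable n : ℕ

x∉p-x : ∀ (p : Subset n) x → x ∉ p - x
x∉p-x (inside  ∷ p) zero ()
x∉p-x (outside ∷ p) zero ()
x∉p-x (s ∷ p) (suc x) (there x∈) = x∉p-x p x x∈

∣p∪q∣≤∣p∣+∣q∣ : ∀ (p q : Subset n) → ∣ p ∪ q ∣ ≤ ∣ p ∣ + ∣ q ∣
∣p∪q∣≤∣p∣+∣q∣ []            []            = z≤n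
∣p∪q∣≤∣p∣+∣q∣ (outside ∷ p) (outside ∷ q) = ∣p∪q∣≤∣p∣+∣q∣ p q
∣p∪q∣≤∣p∣+∣q∣ (outside ∷ p) (inside  ∷ q) = ≤-trans (s≤s (∣p∪q∣≤∣p∣+∣q∣ p q)) (≤-reflexive (≡.sym (+-suc ∣ p ∣ ∣ q ∣)))
∣p∪q∣≤∣p∣+∣q∣ (inside  ∷ p) (outside ∷ q) = s≤s (∣p∪q∣≤∣p∣+∣q∣ p q)
∣p∪q∣≤∣p∣+∣q∣ (inside  ∷ p) (inside  ∷ q) = s≤s (≤-trans (∣p∪q∣≤∣p∣+∣q∣ p q) (+-monoʳ-≤ ∣ p ∣ (n≤1+n ∣ q ∣)))

∣p∣≤1+∣p-x∣ : ∀ (p : Subset n) x → ∣ p ∣ ≤ suc ∣ p - x ∣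
∣p∣≤1+∣p-x∣ p x = ≤-trans (p⊆q⇒∣p∣≤∣q∣ p⊆) (≤-trans (∣p∪q∣≤∣p∣+∣q∣ ⁅ x ⁆ (p - x))
  (≤-reflexive (≡.cong (_+ ∣ p - x ∣) (∣⁅x⁆∣≡1 x))))
  where
  p⊆ : ∀ {y} → y ∈ p → y ∈ ⁅ x ⁆ ∪ (p - x)
  p⊆ {y} y∈p with y ≟ x
  ... | yes ≡.refl = x∈p∪q⁺ (inj₁ (x∈⁅x⁆ x))
  ... | no  y≢x    = x∈p∪q⁺ (inj₂ (x∈p∧x≢y⇒x∈p-y y∈p y≢x))

x∈p-y⇒x∈p : ∀ (p : Subset n) {x y} → x ∈ p - y → x ∈ p
x∈p-y⇒x∈p p {y = y} = p─q⊆p p ⁅ y ⁆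

x∈p-y⇒x≢y : ∀ (p : Subset n) {x y} → x ∈ p - y → x ≢ y
x∈p-y⇒x≢y p x∈ ≡.refl = x∉p-x p _ x∈

0<∣p∣⇒Nonempty : ∀ {n} (p : Subset n) → 0 < ∣ p ∣ → Nonempty p
0<∣p∣⇒Nonempty {n} p 0<∣p∣ with nonempty? p
... | yes p≢∅ = p≢∅
... | no p≡∅ rewrite Empty-unique p≡∅ | ∣⊥∣≡0 n = ⊥-elim (<⇒≱ 0<∣p∣ z≤n)

three-members : ∀ (p : Subset n) → 2 < ∣ p ∣ → ∃ λ i → ∃ λ j → ∃ λ k →
                (i ∈ p × j ∈ p × k ∈ p) × j ≢ i × k ≢ i × k ≢ j
three-members p 2<∣p∣ =
  let 1<      = ≤-pred (≤-trans 2<∣p∣ (∣p∣≤1+∣p-x∣ p _))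
      i , i∈  = 0<∣p∣⇒Nonempty p (≤-trans (s≤s z≤n) 2<∣p∣)
      j , j∈  = 0<∣p∣⇒Nonempty (p - i) (≤-trans (s≤s z≤n) 1<)
      k , k∈  = 0<∣p∣⇒Nonempty (p - i - j) (≤-pred (≤-trans 1< (∣p∣≤1+∣p-x∣ (p - i) j)))
      k∈p-i   = x∈p-y⇒x∈p (p - i) k∈
  in i , j , k , (i∈ , x∈p-y⇒x∈p p j∈ , x∈p-y⇒x∈p p k∈p-i) ,
     x∈p-y⇒x≢y p j∈ , x∈p-y⇒x≢y p k∈p-i , x∈p-y⇒x≢y (p - i) k∈

∣p∣≤2⇒pair : ∀ (p : Subset n) → ∣ p ∣ ≤ 2 → ∀ {i} → i ∈ p → ∃ λ j → ∀ k → k ∈ p → k ≡ i ⊎ k ≡ j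
∣p∣≤2⇒pair p ∣p∣≤2 {i} i∈p with nonempty? (p - i)
-- When `i` is the only member, `j` is `i` itself, so the pair may be degenerate and users must
-- treat that case.
... | no none = i , λ k k∈p → inj₁ (only k k∈p)
  where
  only : ∀ k → k ∈ p → k ≡ i
  only k k∈p with k ≟ i
  ... | yes k≡i = k≡i
  ... | no k≢i  = ⊥-elim (none (k , x∈p∧x≢y⇒x∈p-y k∈p k≢i))
... | yes (j , j∈) = j , cover
  where
  cover : ∀ k → k ∈ p → k ≡ i ⊎ k ≡ j
  cover k k∈p with k ≟ i | k ≟ j
  ... | yes k≡i | _       = inj₁ k≡i
  ... | no _    | yes k≡j = inj₂ k≡j
  ... | no k≢i  | no k≢j  = ⊥-elim (<⇒≱ (≤-trans (s≤s (≤-trans (s≤s (≤-trans (s≤s z≤n)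
        (x∈p⇒∣p-x∣<∣p∣ (x∈p∧x≢y⇒x∈p-y (x∈p∧x≢y⇒x∈p-y k∈p k≢i) k≢j))))
        (x∈p⇒∣p-x∣<∣p∣ j∈))) (x∈p⇒∣p-x∣<∣p∣ i∈p)) ∣p∣≤2)

pair-containing : ∀ {n} (S : Subset (suc n)) → ∣ S ∣ ≤ 2 → ∃ λ i → ∃ λ j → ∀ k → k ∈ S → k ≡ i ⊎ k ≡ j
pair-containing S ∣S∣≤2 with nonempty? S
... | yes (i , i∈S) = i , ∣p∣≤2⇒pair S ∣S∣≤2 i∈S
-- An arbitrary default for empty `S`; it exists because the index set `Fin (suc n)` is inhabited.
... | no empty      = zero , zero , λ k k∈S → ⊥-elim (empty (k , k∈S))

∉⇒lookup : ∀ {p : Subset n} {x} → x ∉ p → lookup p x ≡ outside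
∉⇒lookup {p = p} {x} x∉p with lookup p x in eq
... | inside  = ⊥-elim (x∉p (lookup⇒[]= x p eq))
... | outside = ≡.refl

open Sum +-0-commutativeMonoid using (sum; sum-permute)

-- As a sum of zeros and ones, a cardinality becomes accessible to the permutation invariance of
-- finite sums.
∣tabulate∣ : ∀ {n} (f : Fin n → Bool) → ∣ tabulate f ∣ ≡ sum (λ i → if f i then 1 else 0)
∣tabulate∣ {zero}  f = ≡.refl
∣tabulate∣ {suc n} f with f zero
... | true  = ≡.cong suc (∣tabulate∣ (λ i → f (suc i)))
... | false = ∣tabulate∣ (λ i → f (suc i))

∣image∣ : ∀ (σ : Fin n ↔ Fin n) (I : Subset n) → ∣ image σ I ∣ ≡ ∣ I ∣
∣image∣ σ I = begin
  ∣ image σ I ∣                                           ≡⟨ ∣tabulate∣ (λ j → lookup I (Inverse.from σ j)) ⟩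
  sum (λ j → if lookup I (Inverse.from σ j) then 1 else 0) ≡⟨ sum-permute _ (↔-sym σ) ⟨
  sum (λ i → if lookup I i then 1 else 0)                  ≡⟨ ∣tabulate∣ (lookup I) ⟨
  ∣ tabulate (lookup I) ∣                                  ≡⟨ ≡.cong ∣_∣ (tabulate∘lookup I) ⟩
  ∣ I ∣ ∎
  where open ≡.≡-Reasoning

image-inverse : ∀ (σ : Fin n ↔ Fin n) (J : Subset n) → image σ (image (↔-sym σ) J) ≡ J
image-inverse σ J = ≡.trans
  (tabulate-cong λ j → ≡.trans (lookup∘tabulate _ (Inverse.from σ j)) (≡.cong (lookup J) (Inverse.strictlyInverseˡ σ j)))
  (tabulate∘lookup J)

-- Relabelling preserves cardinality, so a uniform system absorbs the permutation. Later arguments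
-- can treat the vectors in their given order.
uniform-iso : ∀ {p k n} {M : IndepSystem p n} → Isomorphic (U k n) M → ∀ J → U k n J ⇔ M J
uniform-iso {k = k} {M = M} (σ , iso) J =
  ≡.subst₂ (λ s J′ → (s ≤ k) ⇔ M J′) (∣image∣ (↔-sym σ) J) (image-inverse σ J) (iso (image (↔-sym σ) J))

-- Linear combinations and modular independence

module Combinations {c ℓ a b} {R : CommutativeRing c ℓ} (V : Module R a b) where

  open CommutativeRing R renaming (_+_ to _⊕_; _*_ to _⊗_; refl to ≈-refl; trans to ≈-trans; sym to ≈-sym)
    hiding (zero; _-_)
  open Module V
  open Algebra.Properties.CommutativeSemigroup (CommutativeMonoid.commutativeSemigroup +ᴹ-commutativeMonoid)
    using (interchange)

  sumᴹ-cong : ∀ {n} {f g : Fin n → Carrierᴹ} → (∀ i → f i ≈ᴹ g i) → sumᴹ R V f ≈ᴹ sumᴹ R V g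
  sumᴹ-cong {zero}  eq = ≈ᴹ-refl
  sumᴹ-cong {suc n} eq = +ᴹ-cong (eq zero) (sumᴹ-cong (λ i → eq (suc i)))

  sumᴹ-+ : ∀ {n} (f g : Fin n → Carrierᴹ) → sumᴹ R V (λ i → f i +ᴹ g i) ≈ᴹ sumᴹ R V f +ᴹ sumᴹ R V g
  sumᴹ-+ {zero}  f g = ≈ᴹ-sym (+ᴹ-identityˡ 0ᴹ)
  sumᴹ-+ {suc n} f g = ≈ᴹ-trans (+ᴹ-congˡ (sumᴹ-+ (λ i → f (suc i)) (λ i → g (suc i)))) (interchange _ _ _ _)

  sumᴹ-* : ∀ {n} d (f : Fin n → Carrierᴹ) → sumᴹ R V (λ i → d *ₗ f i) ≈ᴹ d *ₗ sumᴹ R V f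
  sumᴹ-* {zero}  d f = ≈ᴹ-sym (*ₗ-zeroʳ d)
  sumᴹ-* {suc n} d f = ≈ᴹ-trans (+ᴹ-congˡ (sumᴹ-* d (λ i → f (suc i)))) (≈ᴹ-sym (*ₗ-distribˡ d _ _))

  sumᴹ-zero : ∀ {n} {f : Fin n → Carrierᴹ} → (∀ i → f i ≈ᴹ 0ᴹ) → sumᴹ R V f ≈ᴹ 0ᴹ
  sumᴹ-zero {zero}  f≈0 = ≈ᴹ-refl
  sumᴹ-zero {suc n} f≈0 = ≈ᴹ-trans (+ᴹ-cong (f≈0 zero) (sumᴹ-zero (λ i → f≈0 (suc i)))) (+ᴹ-identityˡ 0ᴹ)

  sumᴹ-single : ∀ {n} {f : Fin n → Carrierᴹ} i → (∀ k → i ≢ k → f k ≈ᴹ 0ᴹ) → sumᴹ R V f ≈ᴹ f i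
  sumᴹ-single zero f≈0 = ≈ᴹ-trans (+ᴹ-congˡ (sumᴹ-zero (λ k → f≈0 (suc k) λ ()))) (+ᴹ-identityʳ _)
  sumᴹ-single (suc i) f≈0 = ≈ᴹ-trans
    (+ᴹ-cong (f≈0 zero λ ()) (sumᴹ-single i (λ k i≢k → f≈0 (suc k) λ { ≡.refl → i≢k ≡.refl })))
    (+ᴹ-identityˡ _)

  δ : Fin n → Fin n → Carrier
  δ i k = if does (i ≟ k) then 1# else 0#

  δ-same : ∀ (i : Fin n) → δ i i ≈ 1#
  δ-same i with i ≟ i
  ... | yes _  = ≈-refl
  ... | no i≢i = ⊥-elim (i≢i ≡.refl)

  δ-diff : ∀ (i k : Fin n) → i ≢ k → δ i k ≈ 0#
  δ-diff i k i≢k with i ≟ k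
  ... | yes i≡k = ⊥-elim (i≢k i≡k)
  ... | no _    = ≈-refl

  Supp : (Fin n → Carrier) → Subset n → Set ℓ
  Supp α I = ∀ k → k ∉ I → α k ≈ 0#

  -- Zeroing coefficients outside `I` turns the guarded sums of `ModIndep` into plain linear
  -- combinations, which are additive and homogeneous in the coefficients.
  mask : Subset n → (Fin n → Carrier) → Fin n → Carrier
  mask I α i = if lookup I i then α i else 0#

  mask-supp : ∀ (I : Subset n) α → Supp (mask I α) I
  mask-supp I α k k∉I rewrite ∉⇒lookup k∉I = ≈-refl

  mask-on : ∀ (I : Subset n) α {k} → k ∈ I → mask I α k ≡ α k
  mask-on I α k∈I rewrite []=⇒lookup k∈I = ≡.refl

  mask-supported : ∀ (I : Subset n) {α} → Supp α I → ∀ i → mask I α i ≈ α i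
  mask-supported I α⊆I i with i ∈? I
  ... | yes i∈I rewrite []=⇒lookup i∈I = ≈-refl
  ... | no  i∉I rewrite ∉⇒lookup i∉I = ≈-sym (α⊆I i i∉I)

  module _ {n} (v : Fin n → Carrierᴹ) where

    comb : (Fin n → Carrier) → Carrierᴹ
    comb α = sumᴹ R V (λ i → α i *ₗ v i)

    comb-cong : ∀ {α β} → (∀ i → α i ≈ β i) → comb α ≈ᴹ comb β
    comb-cong eq = sumᴹ-cong (λ i → *ₗ-congʳ (eq i))

    comb-+ : ∀ α β → comb (λ i → α i ⊕ β i) ≈ᴹ comb α +ᴹ comb β
    comb-+ α β = ≈ᴹ-trans (sumᴹ-cong (λ i → *ₗ-distribʳ (v i) (α i) (β i)))
      (sumᴹ-+ (λ i → α i *ₗ v i) (λ i → β i *ₗ v i))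

    comb-* : ∀ d α → comb (λ i → d ⊗ α i) ≈ᴹ d *ₗ comb α
    comb-* d α = ≈ᴹ-trans (sumᴹ-cong (λ i → *ₗ-assoc d (α i) (v i))) (sumᴹ-* d (λ i → α i *ₗ v i))

    comb-δ : ∀ i → comb (δ i) ≈ᴹ v i
    comb-δ i = ≈ᴹ-trans
      (sumᴹ-single i (λ k i≢k → ≈ᴹ-trans (*ₗ-congʳ (δ-diff i k i≢k)) (*ₗ-zeroˡ (v k))))
      (≈ᴹ-trans (*ₗ-congʳ (δ-same i)) (*ₗ-identityˡ (v i)))

    comb-*δ : ∀ d i → comb (λ k → d ⊗ δ i k) ≈ᴹ d *ₗ v i
    comb-*δ d i = ≈ᴹ-trans (comb-* d (δ i)) (*ₗ-congˡ (comb-δ i))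

    comb-mask : ∀ I α → sumᴹ R V (λ i → if lookup I i then α i *ₗ v i else 0ᴹ) ≈ᴹ comb (mask I α)
    comb-mask I α = sumᴹ-cong term
      where
      term : ∀ i → (if lookup I i then α i *ₗ v i else 0ᴹ) ≈ᴹ mask I α i *ₗ v i
      term i with lookup I i
      ... | true  = ≈ᴹ-refl
      ... | false = ≈ᴹ-sym (*ₗ-zeroˡ (v i))

    module _ (m : PredR R) (m-isIdeal : IsIdeal R m) (m? : ∀ x → Dec (m x)) where

      independent⇒ : ∀ {I α} → ModIndep R V m v I → comb α ≈ᴹ 0ᴹ → Supp α I → ∀ i → m (α i)
      independent⇒ {I} {α} indep rel α⊆I i with i ∈? I
      ... | yes i∈I = indep α (≈ᴹ-trans (comb-mask I α) (≈ᴹ-trans (comb-cong (mask-supported I α⊆I)) rel)) i i∈I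
      ... | no  i∉I = IsIdeal.resp m-isIdeal (≈-sym (α⊆I i i∉I)) (IsIdeal.zero∈ m-isIdeal)

      -- Equality in V need not be decidable, so a relation exists only up to double negation.
      dependent⇒ : ∀ {I} → ¬ ModIndep R V m v I →
        ¬ ¬ (∃ λ α → comb α ≈ᴹ 0ᴹ × Supp α I × ∃ λ i → i ∈ I × ¬ m (α i))
      dependent⇒ {I} dep none = dep λ α rel i i∈I → contra α rel i i∈I (m? (α i))
        where
        contra : ∀ α → sumᴹ R V (λ i → if lookup I i then α i *ₗ v i else 0ᴹ) ≈ᴹ 0ᴹ →
                 ∀ i → i ∈ I → Dec (m (α i)) → m (α i)
        contra α rel i i∈I (yes αᵢ∈m) = αᵢ∈m
        contra α rel i i∈I (no αᵢ∉m) = ⊥-elim (none (mask I α , ≈ᴹ-trans (≈ᴹ-sym (comb-mask I α)) rel ,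
          mask-supp I α , i , i∈I , λ p → αᵢ∉m (≡.subst m (mask-on I α i∈I) p)))

-- Finite chain rings

module ChainRing {c ℓ} (R : CommutativeRing c ℓ) (m : PredR R) (q μ : ℕ)
  (finite : IsFinite R) (chain : IsChainRing R) (local : IsLocalWith R m)
  (residue : ResidueCard R m q) (nil : NilIndex R m (suc μ)) where

  open CommutativeRing R renaming (_+_ to _⊕_; _*_ to _⊗_; _-_ to _⊖_) hiding (zero)
  open Algebra.Properties.Ring ring using (-0#≈0#; -1*x≈-x; x[y-z]≈xy-xz; +-cancelʳ)
    renaming (x≈y⇒x∙y⁻¹≈ε to x≈y⇒x-y≈0; ⁻¹-anti-homo‿- to -[x-y]≈y-x; xyx⁻¹≈y to x+y-x≈y; //-rightDividesˡ to y-x+x≈y)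
  open Algebra.Properties.Semiring.Exp semiring using () renaming (_^_ to _^ᴿ_)
  open Algebra.Solver.Ring.NaturalCoefficients.Default commutativeSemiring
  open Relation.Binary.Reasoning.Setoid setoid

  open IsIdeal (proj₁ local) public
    renaming (resp to m-resp; zero∈ to 0∈m; +-closed to m-+; *-closed to m-*)

  1∉m : ¬ m 1#
  1∉m = proj₁ (proj₂ local)

  rep : Fin q → Carrier
  rep = proj₁ residue

  m-neg : ∀ {x} → m x → m (- x)
  m-neg {x} mx = m-resp (-1*x≈-x x) (m-* (- 1#) mx)

  telescope : ∀ x y z → (x ⊖ y) ⊕ (y ⊖ z) ≈ x ⊖ z
  telescope x y z = begin
    (x ⊖ y) ⊕ (y ⊖ z)       ≈⟨ +-assoc x (- y) (y ⊖ z) ⟩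
    x ⊕ (- y ⊕ (y ⊖ z))     ≈⟨ +-congˡ (+-assoc (- y) y (- z)) ⟨
    x ⊕ ((- y ⊕ y) ⊕ - z)   ≈⟨ +-congˡ (+-congʳ (-‿inverseˡ y)) ⟩
    x ⊕ (0# ⊕ - z)          ≈⟨ +-congˡ (+-identityˡ (- z)) ⟩
    x ⊖ z ∎

  x-0≈x : ∀ x → x ⊖ 0# ≈ x
  x-0≈x x = trans (+-congˡ -0#≈0#) (+-identityʳ x)

  -- Congruence modulo the maximal ideal

  infix 4 _∼_
  _∼_ : Carrier → Carrier → Set (c ⊔ ℓ)
  x ∼ y = m (x ⊖ y)

  ∼-sym : ∀ {x y} → x ∼ y → y ∼ x
  ∼-sym {x} {y} p = m-resp (-[x-y]≈y-x x y) (m-neg p)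

  ∼-trans : ∀ {x y z} → x ∼ y → y ∼ z → x ∼ z
  ∼-trans {x} {y} {z} p p′ = m-resp (telescope x y z) (m-+ p p′)

  rep-injective : ∀ {i j} → rep i ∼ rep j → i ≡ j
  rep-injective = proj₁ (proj₂ residue) _ _

  class : ∀ x → ∃ λ i → x ∼ rep i
  class = proj₂ (proj₂ residue)

  -- Membership means lying in the residue class of 0, and the finitely many class indices can be
  -- compared.
  m? : ∀ x → Dec (m x)
  m? x with class x | class 0#
  ... | i , x∼i | j , 0∼j with i ≟ j
  ...   | yes ≡.refl = yes (m-resp (x-0≈x x) (∼-trans x∼i (∼-sym 0∼j)))
  ...   | no i≢j     = no λ mx →
            i≢j (rep-injective (∼-trans (∼-sym x∼i) (∼-trans (m-resp (sym (x-0≈x x)) mx) 0∼j)))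

  -- Principal ideals, read as divisibility: `⟨ x ⟩ y` says that x divides y

  ⟨_⟩ : Carrier → PredR R
  ⟨ x ⟩ y = ∃ λ d → y ≈ d ⊗ x

  ⟨⟩-isIdeal : ∀ x → IsIdeal R ⟨ x ⟩
  ⟨⟩-isIdeal x = record
    { resp     = λ { y≈z (d , eq) → d , trans (sym y≈z) eq }
    ; zero∈    = 0# , sym (zeroˡ x)
    ; +-closed = λ { (d , eq) (d′ , eq′) → d ⊕ d′ , trans (+-cong eq eq′) (sym (distribʳ x d d′)) }
    ; *-closed = λ { r (d , eq) → r ⊗ d , trans (*-congˡ eq) (sym (*-assoc r d x)) }
    }

  x∈⟨x⟩ : ∀ x → ⟨ x ⟩ x
  x∈⟨x⟩ x = 1# , sym (*-identityˡ x)

  ∣-total : ∀ x y → ⟨ x ⟩ y ⊎ ⟨ y ⟩ x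
  ∣-total x y with chain ⟨ x ⟩ ⟨ y ⟩ (⟨⟩-isIdeal x) (⟨⟩-isIdeal y)
  ... | inj₁ x⊆y = inj₂ (x⊆y x (x∈⟨x⟩ x))
  ... | inj₂ y⊆x = inj₁ (y⊆x y (x∈⟨x⟩ y))

  ∣-trans : ∀ {x y z} → ⟨ x ⟩ y → ⟨ y ⟩ z → ⟨ x ⟩ z
  ∣-trans {x} (d , eq) (e , eq′) = e ⊗ d , trans eq′ (trans (*-congˡ eq) (sym (*-assoc e d x)))

  -- The power is a one-term sum of products of ν elements of `m`, hence lies in the vanishing power
  -- of the ideal.
  z^ν≈0 : ∀ {z} → m z → z ^ᴿ suc μ ≈ 0#
  z^ν≈0 {z} mz = proj₁ nil _ (1 , (λ _ → z ^ᴿ suc μ) ,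
    (λ _ → (λ _ → z) , (λ _ → mz) , prod-const (suc μ)) , sym (+-identityʳ _))
    where
    prod-const : ∀ k → z ^ᴿ k ≈ prodR R {k} (λ _ → z)
    prod-const zero    = refl
    prod-const (suc k) = *-congˡ (prod-const k)

  -- The witness is the partial geometric sum 1 + z + ... + z^(k-1), since (1 - z) times it is 1 -
  -- z^k. Stated additively, the identity involves no subtraction.
  geometric : ∀ {u z} → u ⊕ z ≈ 1# → ∀ k → ∃ λ y → u ⊗ y ⊕ z ^ᴿ k ≈ 1#
  geometric {u} {z} eq zero = 0# , trans (+-congʳ (zeroʳ u)) (+-identityˡ 1#)
  geometric {u} {z} eq (suc k) with geometric eq k
  ... | y , eq′ = 1# ⊕ z ⊗ y , (begin
    u ⊗ (1# ⊕ z ⊗ y) ⊕ z ⊗ z ^ᴿ k ≈⟨ solve 4 (λ u z y w →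
        u :* (con 1 :+ z :* y) :+ z :* w := u :+ z :* (u :* y :+ w)) refl u z y (z ^ᴿ k) ⟩
    u ⊕ z ⊗ (u ⊗ y ⊕ z ^ᴿ k)      ≈⟨ +-congˡ (*-congˡ eq′) ⟩
    u ⊕ z ⊗ 1#                    ≈⟨ +-congˡ (*-identityʳ z) ⟩
    u ⊕ z                         ≈⟨ eq ⟩
    1# ∎)

  -- Maximality of m only shows that x is not non-invertible; the inverse is then found by
  -- searching the finitely many residue classes.
  inverse-mod-m : ∀ {x} → ¬ m x → ∃ λ i → 1# ∼ x ⊗ rep i
  inverse-mod-m {x} x∉m with any? (λ i → m? (1# ⊖ x ⊗ rep i))
  ... | yes found = found
  ... | no none = ⊥-elim (x∉m (proj₂ (proj₂ local) ⟨ x ⟩ (⟨⟩-isIdeal x) proper x (x∈⟨x⟩ x)))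
    where
    proper : Proper R ⟨ x ⟩
    proper (y , 1≈yx) with class y
    ... | i , y∼i = none (i , m-resp
          (trans (x[y-z]≈xy-xz x y (rep i)) (+-congʳ (sym (trans 1≈yx (*-comm y x))))) (m-* x y∼i))

  -- With z = 1 - u in `m`, the geometric series for 1/(1 - z) stops because z is nilpotent.
  ∼1⇒unit : ∀ {u} → 1# ∼ u → ∃ λ y → u ⊗ y ≈ 1#
  ∼1⇒unit {u} mz = y , (begin
    u ⊗ y                       ≈⟨ +-identityʳ _ ⟨
    u ⊗ y ⊕ 0#                  ≈⟨ +-congˡ (z^ν≈0 mz) ⟨
    u ⊗ y ⊕ (1# ⊖ u) ^ᴿ suc μ   ≈⟨ proj₂ (geometric u+z≈1 (suc μ)) ⟩
    1# ∎)
    where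
    u+z≈1 : u ⊕ (1# ⊖ u) ≈ 1#
    u+z≈1 = trans (+-comm _ _) (y-x+x≈y u 1#)
    y = proj₁ (geometric u+z≈1 (suc μ))

  inverse : ∀ {x} → ¬ m x → ∃ λ y → y ⊗ x ≈ 1#
  inverse {x} x∉m =
    let i , mz = inverse-mod-m x∉m
        y , eq = ∼1⇒unit mz
    in rep i ⊗ y , trans (solve 3 (λ r y x → r :* y :* x := x :* r :* y) refl (rep i) y x) eq

  unit-cancels : ∀ {w d} → ¬ m d → w ⊗ d ≈ 0# → w ≈ 0#
  unit-cancels {w} {d} d∉m wd≈0 =
    let u , ud≈1 = inverse d∉m in begin
    w            ≈⟨ *-identityʳ w ⟨
    w ⊗ 1#       ≈⟨ *-congˡ ud≈1 ⟨
    w ⊗ (u ⊗ d)  ≈⟨ solve 3 (λ w u d → w :* (u :* d) := u :* (w :* d)) refl w u d ⟩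
    u ⊗ (w ⊗ d)  ≈⟨ *-congˡ wd≈0 ⟩
    u ⊗ 0#       ≈⟨ zeroʳ u ⟩
    0# ∎

  -- Divisibility is total, so a running minimum over the members of `m` in the list divides all of
  -- them; it starts at 0.
  common-divisor : ∀ N (e : Fin N → Carrier) → ∃ λ π → m π × (∀ i → m (e i) → ⟨ π ⟩ (e i))
  common-divisor zero    e = 0# , 0∈m , λ ()
  common-divisor (suc N) e with common-divisor N (λ i → e (suc i)) | m? (e zero)
  ... | π , mπ , π∣ | no e₀∉m = π , mπ , λ { zero mi → ⊥-elim (e₀∉m mi) ; (suc i) mi → π∣ i mi }
  ... | π , mπ , π∣ | yes e₀∈m with ∣-total π (e zero)
  ...   | inj₁ π∣e₀ = π , mπ , λ { zero _ → π∣e₀ ; (suc i) mi → π∣ i mi }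
  ...   | inj₂ e₀∣π = e zero , e₀∈m , λ { zero _ → x∈⟨x⟩ (e zero) ; (suc i) mi → ∣-trans e₀∣π (π∣ i mi) }

  uniformizer : ∃ λ π → m π × (∀ {x} → m x → ⟨ π ⟩ x)
  uniformizer with common-divisor (proj₁ finite) (proj₁ (proj₂ finite))
  ... | π , mπ , π∣ = π , mπ , λ {x} mx →
    let i , eᵢ≈x  = proj₂ (proj₂ finite) x
        d , eᵢ≈dπ = π∣ i (m-resp (sym eᵢ≈x) mx)
    in d , trans (sym eᵢ≈x) eᵢ≈dπ

  -- Digit expansions in powers of the uniformizer and points of the projective line

  module Digits (π : Carrier) (π∈m : m π) (π-generates : ∀ {x} → m x → ⟨ π ⟩ x) where

    π∣⇒m : ∀ {x} → ⟨ π ⟩ x → m x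
    π∣⇒m (d , eq) = m-resp (sym eq) (m-* d π∈m)

    -- Every product of j elements of `m` is a multiple of π^j. If that power vanished, so would the
    -- j-th power of `m`, against the minimality of ν.
    π^j≉0 : ∀ {j} → j < suc μ → ¬ π ^ᴿ j ≈ 0#
    π^j≉0 {j} j<ν πʲ≈0 = proj₂ nil j j<ν λ { x (t , ys , prods , x≈Σ) → trans x≈Σ (sum-zero t (λ i → ys-zero (prods i))) }
      where
      prod-divisible : ∀ k (v : Fin k → Carrier) → (∀ i → m (v i)) → ⟨ π ^ᴿ k ⟩ (prodR R v)
      prod-divisible zero    v mv = x∈⟨x⟩ 1#
      prod-divisible (suc k) v mv with π-generates (mv zero) | prod-divisible k (λ i → v (suc i)) (λ i → mv (suc i))
      ... | a , eq | d , eq′ = a ⊗ d , trans (*-cong eq eq′)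
            (solve 4 (λ a p d w → (a :* p) :* (d :* w) := (a :* d) :* (p :* w)) refl a π d (π ^ᴿ k))

      ys-zero : ∀ {y} → ProdOf R m j y → y ≈ 0#
      ys-zero (v , mv , y≈) with prod-divisible j v mv
      ... | d , eq = trans y≈ (trans eq (trans (*-congˡ πʲ≈0) (zeroʳ d)))

      sum-zero : ∀ t {ys : Fin t → Carrier} → (∀ i → ys i ≈ 0#) → sumR R ys ≈ 0#
      sum-zero zero    z = refl
      sum-zero (suc t) z = trans (+-cong (z zero) (sum-zero t (λ i → z (suc i)))) (+-identityˡ 0#)

    -- The π-adic number with k digits, lowest digit first; the digits are residue representatives
    -- and the index encodes the digit string.
    expand : ∀ k → Fin (q ^ k) → Carrier
    expand zero    _ = 0#
    expand (suc k) p = rep (proj₁ (remQuot (q ^ k) p)) ⊕ π ⊗ expand k (proj₂ (remQuot {q} (q ^ k) p))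

    expand-surjective : ∀ k x → ∃ λ p → ∃ λ y → x ≈ expand k p ⊕ y ⊗ π ^ᴿ k
    expand-surjective zero x = zero , x , sym (trans (+-identityˡ _) (*-identityʳ x))
    expand-surjective (suc k) x with class x
    ... | i , x∼i with π-generates x∼i
    ... | x′ , eq with expand-surjective k x′
    ... | p , y , eq′ = combine i p , y , (begin
      x                                            ≈⟨ y-x+x≈y (rep i) x ⟨
      (x ⊖ rep i) ⊕ rep i                          ≈⟨ +-congʳ (trans eq (*-congʳ eq′)) ⟩
      (expand k p ⊕ y ⊗ π ^ᴿ k) ⊗ π ⊕ rep i        ≈⟨ solve 5 (λ e y w p r →
          (e :+ y :* w) :* p :+ r := (r :+ p :* e) :+ y :* (p :* w)) refl (expand k p) y (π ^ᴿ k) π (rep i) ⟩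
      (rep i ⊕ π ⊗ expand k p) ⊕ y ⊗ (π ⊗ π ^ᴿ k)  ≡⟨ ≡.cong (λ ip →
          (rep (proj₁ ip) ⊕ π ⊗ expand k (proj₂ ip)) ⊕ y ⊗ (π ⊗ π ^ᴿ k)) (remQuot-combine i p) ⟨
      expand (suc k) (combine i p) ⊕ y ⊗ (π ⊗ π ^ᴿ k) ∎)

    shift : ∀ p w r e → p ⊗ w ⊗ e ⊕ w ⊗ r ≈ w ⊗ (r ⊕ p ⊗ e)
    shift = solve 4 (λ p w r e → p :* w :* e :+ w :* r := w :* (r :+ p :* e)) refl

    -- Multiplying by π ^ j loses the last j of the ν digits, hence the bound on the number k of digits.
    expand-injective : ∀ k j → j + k ≤ suc μ → ∀ p p′ →
      π ^ᴿ j ⊗ expand k p ≈ π ^ᴿ j ⊗ expand k p′ → p ≡ p′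
    expand-injective zero    j _ zero zero _ = ≡.refl
    expand-injective (suc k) j j+k≤ν p p′ eq =
      ≡.trans (≡.sym (combine-remQuot {q} (q ^ k) p))
        (≡.trans (≡.cong₂ combine i≡i′ s≡s′) (combine-remQuot {q} (q ^ k) p′))
      where
      i  = proj₁ (remQuot {q} (q ^ k) p)
      i′ = proj₁ (remQuot {q} (q ^ k) p′)
      s  = proj₂ (remQuot {q} (q ^ k) p)
      s′ = proj₂ (remQuot {q} (q ^ k) p′)
      E  = expand (suc k) p
      E′ = expand (suc k) p′
      1+j+k≤ν : suc j + k ≤ suc μ
      1+j+k≤ν = ≤-trans (≤-reflexive (≡.sym (+-suc j k))) j+k≤ν

      head∼ : ∀ p → expand (suc k) p ∼ rep (proj₁ (remQuot {q} (q ^ k) p))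
      head∼ p = m-resp (sym (begin
        (r ⊕ t) ⊖ r     ≈⟨ x+y-x≈y r t ⟩
        t               ≈⟨ *-comm π _ ⟩
        expand k (proj₂ (remQuot {q} (q ^ k) p)) ⊗ π ∎)) (m-* _ π∈m)
        where
        r = rep (proj₁ (remQuot {q} (q ^ k) p))
        t = π ⊗ expand k (proj₂ (remQuot {q} (q ^ k) p))

      E∼E′ : E ∼ E′
      E∼E′ with m? (E ⊖ E′)
      ... | yes E∼E′ = E∼E′
      -- Otherwise E - E′ is a unit annihilated by π^j, which forces π^j = 0 although j < ν.
      ... | no E≁E′ = ⊥-elim (π^j≉0 (≤-trans (m≤m+n (suc j) k) 1+j+k≤ν)
              (unit-cancels E≁E′ (trans (x[y-z]≈xy-xz (π ^ᴿ j) E E′) (x≈y⇒x-y≈0 eq))))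

      i≡i′ : i ≡ i′
      i≡i′ = rep-injective (∼-trans (∼-sym (head∼ p)) (∼-trans E∼E′ (head∼ p′)))

      s≡s′ : s ≡ s′
      -- The lowest digits agree and cancel; the factor π in front of the tails is moved into the
      -- power, raising j by one.
      s≡s′ = expand-injective k (suc j) 1+j+k≤ν s s′ (+-cancelʳ _ _ _ (begin
        π ⊗ π ^ᴿ j ⊗ expand k s ⊕ π ^ᴿ j ⊗ rep i      ≈⟨ shift π _ _ _ ⟩
        π ^ᴿ j ⊗ E                                    ≈⟨ eq ⟩
        π ^ᴿ j ⊗ E′                                   ≈⟨ shift π _ _ _ ⟨
        π ⊗ π ^ᴿ j ⊗ expand k s′ ⊕ π ^ᴿ j ⊗ rep i′    ≡⟨ ≡.cong (λ i → π ⊗ π ^ᴿ j ⊗ expand k s′ ⊕ π ^ᴿ j ⊗ rep i) i≡i′ ⟨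
        π ⊗ π ^ᴿ j ⊗ expand k s′ ⊕ π ^ᴿ j ⊗ rep i ∎))

    expand-full : ∀ x → ∃ λ p → x ≈ expand (suc μ) p
    expand-full x =
      let p , y , eq = expand-surjective (suc μ) x
      in p , trans eq (trans (+-congˡ (trans (*-congˡ (z^ν≈0 π∈m)) (zeroʳ y))) (+-identityʳ _))

    -- After dividing by π, the remainder beyond μ digits is multiplied by π^(μ+1) = 0, so μ digits
    -- suffice.
    expand-m : ∀ {x} → m x → ∃ λ p → x ≈ π ⊗ expand μ p
    expand-m {x} mx =
      let x′ , x≈x′π = π-generates mx
          p , y , eq = expand-surjective μ x′
      in p , (begin
        x                                           ≈⟨ x≈x′π ⟩
        x′ ⊗ π                                      ≈⟨ *-congʳ eq ⟩
        (expand μ p ⊕ y ⊗ π ^ᴿ μ) ⊗ π               ≈⟨ rearrange _ _ _ _ ⟩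
        π ⊗ expand μ p ⊕ y ⊗ π ^ᴿ suc μ             ≈⟨ +-congˡ (trans (*-congˡ (z^ν≈0 π∈m)) (zeroʳ y)) ⟩
        π ⊗ expand μ p ⊕ 0#                         ≈⟨ +-identityʳ _ ⟩
        π ⊗ expand μ p ∎)
      where
      rearrange : ∀ e y w p → (e ⊕ y ⊗ w) ⊗ p ≈ p ⊗ e ⊕ y ⊗ (p ⊗ w)
      rearrange = solve 4 (λ e y w p → (e :+ y :* w) :* p := p :* e :+ y :* (p :* w)) refl

    -- Representatives (1 : t) and (s : 1), s ∈ m, of the points of the projective line over R.
    coords : Fin (q ^ suc μ) ⊎ Fin (q ^ μ) → Carrier × Carrier
    coords (inj₁ p) = 1# , expand (suc μ) p
    coords (inj₂ p) = π ⊗ expand μ p , 1#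

    -- For two vectors of the same type the coordinate 1 forces d = 1, leaving equality of
    -- expansions. For different types it would put 1 into `m`.
    coords-injective : ∀ s t d → proj₁ (coords s) ≈ d ⊗ proj₁ (coords t) →
                       proj₂ (coords s) ≈ d ⊗ proj₂ (coords t) → s ≡ t
    coords-injective (inj₁ p) (inj₁ p′) d eq₁ eq₂ =
      ≡.cong inj₁ (expand-injective (suc μ) 0 ≤-refl p p′
        (*-congˡ (trans eq₂ (trans (*-congʳ (trans (sym (*-identityʳ d)) (sym eq₁))) (*-identityˡ _)))))
    coords-injective (inj₁ p) (inj₂ p′) d eq₁ eq₂ =
      ⊥-elim (1∉m (m-resp (sym eq₁) (m-* d (π∣⇒m (_ , *-comm π _)))))
    coords-injective (inj₂ p) (inj₁ p′) d eq₁ eq₂ =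
      ⊥-elim (1∉m (m-resp (sym (trans eq₂ (*-comm d _)))
        (m-* _ (m-resp (trans eq₁ (*-identityʳ d)) (π∣⇒m (_ , *-comm π _))))))
    coords-injective (inj₂ p) (inj₂ p′) d eq₁ eq₂ =
      -- Here j = 1 and k = μ, which exactly meets the bound ν; the identity laws only convert
      -- between π and π^1.
      ≡.cong inj₂ (expand-injective μ 1 ≤-refl p p′ (trans (*-congʳ (*-identityʳ π))
        (trans (trans eq₁ (trans (*-congʳ (trans (sym (*-identityʳ d)) (sym eq₂))) (*-identityˡ _)))
          (*-congʳ (sym (*-identityʳ π))))))

    coords-nonzero : ∀ s → ¬ (proj₁ (coords s) ≈ 0# × proj₂ (coords s) ≈ 0#)
    coords-nonzero (inj₁ _) (1≈0 , _) = 1∉m (m-resp (sym 1≈0) 0∈m)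
    coords-nonzero (inj₂ _) (_ , 1≈0) = 1∉m (m-resp (sym 1≈0) 0∈m)

    -- If y = tx, the vector is x(1, t). If x = sy, it is y(s, 1) for s in `m`; for a unit s it is
    -- x(1, u) with u the inverse of s.
    coords-cover : ∀ x y → ∃ λ s → ∃ λ d → x ≈ d ⊗ proj₁ (coords s) × y ≈ d ⊗ proj₂ (coords s)
    coords-cover x y with ∣-total x y
    ... | inj₁ (t , y≈tx) =
      let p , t≈ = expand-full t
      in inj₁ p , x , sym (*-identityʳ x) , trans y≈tx (trans (*-comm t x) (*-congˡ t≈))
    ... | inj₂ (s , x≈sy) with m? s
    ...   | yes s∈m =
      let p , s≈ = expand-m s∈m
      in inj₂ p , y , trans x≈sy (trans (*-comm s y) (*-congˡ s≈)) , sym (*-identityʳ y)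
    ...   | no s∉m =
      let u , us≈1 = inverse s∉m
          p , u≈   = expand-full u
      in inj₁ p , x , sym (*-identityʳ x) , (begin
        y             ≈⟨ *-identityˡ y ⟨
        1# ⊗ y        ≈⟨ *-congʳ us≈1 ⟨
        u ⊗ s ⊗ y     ≈⟨ *-assoc u s y ⟩
        u ⊗ (s ⊗ y)   ≈⟨ *-cong u≈ (sym x≈sy) ⟩
        expand (suc μ) p ⊗ x ≈⟨ *-comm _ x ⟩
        x ⊗ expand (suc μ) p ∎)

    point : Fin (q ^ suc μ + q ^ μ) → Carrier × Carrier
    point i = coords (splitAt (q ^ suc μ) i)

    point-injective : ∀ i j d → proj₁ (point i) ≈ d ⊗ proj₁ (point j) →
                      proj₂ (point i) ≈ d ⊗ proj₂ (point j) → i ≡ j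
    point-injective i j d eq₁ eq₂ =
      ≡.trans (≡.sym (join-splitAt (q ^ suc μ) (q ^ μ) i))
        (≡.trans (≡.cong (join _ _) (coords-injective (splitAt _ i) (splitAt _ j) d eq₁ eq₂))
          (join-splitAt (q ^ suc μ) (q ^ μ) j))

    -- Two vectors on the same point (multiples d·w and e·w) are comparable, since d and e are.
    incomparable⇒bounded : ∀ {n} (x y : Fin n → Carrier) →
      (∀ {i j} → i ≢ j → ∀ d → x i ≈ d ⊗ x j → y i ≈ d ⊗ y j → ⊥) → n ≤ q ^ suc μ + q ^ μ
    incomparable⇒bounded {n} x y incomparable = ≮⇒≥ λ N<n →
      let i , j , i<j , same = pigeonhole N<n (λ i → join _ _ (slope i))
          _ , eqxᵢ , eqyᵢ    = proj₂ (cover i)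
          _ , eqxⱼ , eqyⱼ    = proj₂ (cover j)
      in collide {s = slope i} {slope j} (<⇒≢ i<j) (join-injective {slope i} {slope j} same) eqxᵢ eqyᵢ eqxⱼ eqyⱼ
      where
      cover = λ i → coords-cover (x i) (y i)
      slope = λ i → proj₁ (cover i)

      join-injective : ∀ {s t : Fin (q ^ suc μ) ⊎ Fin (q ^ μ)} → join _ _ s ≡ join _ _ t → s ≡ t
      join-injective {s} {t} eq = ≡.trans (≡.sym (splitAt-join _ _ s))
        (≡.trans (≡.cong (splitAt _) eq) (splitAt-join _ _ t))

      proportional : ∀ {d e f z xᵢ xⱼ} → xᵢ ≈ d ⊗ z → xⱼ ≈ e ⊗ z → d ≈ f ⊗ e → xᵢ ≈ f ⊗ xⱼ
      proportional eqᵢ eqⱼ d≈fe = trans eqᵢ (trans (*-congʳ d≈fe) (trans (*-assoc _ _ _) (*-congˡ (sym eqⱼ))))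

      collide : ∀ {i j s t d e} → i ≢ j → s ≡ t →
        x i ≈ d ⊗ proj₁ (coords s) → y i ≈ d ⊗ proj₂ (coords s) →
        x j ≈ e ⊗ proj₁ (coords t) → y j ≈ e ⊗ proj₂ (coords t) → ⊥
      collide {d = d} {e} i≢j ≡.refl xᵢ yᵢ xⱼ yⱼ with ∣-total d e
      ... | inj₁ (f , e≈fd) = incomparable (λ j≡i → i≢j (≡.sym j≡i)) f (proportional xⱼ xᵢ e≈fd) (proportional yⱼ yᵢ e≈fd)
      ... | inj₂ (f , d≈fe) = incomparable i≢j f (proportional xᵢ xⱼ d≈fe) (proportional yᵢ yⱼ d≈fe)

-- Representations of uniform matroids of rank and corank two

module Representations {c ℓ} (R : CommutativeRing c ℓ) (m : PredR R) (q μ : ℕ)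
  (finite : IsFinite R) (chain : IsChainRing R) (local : IsLocalWith R m)
  (residue : ResidueCard R m q) (nil : NilIndex R m (suc μ)) where

  open CommutativeRing R renaming (_+_ to _⊕_; _*_ to _⊗_; _-_ to _⊖_) hiding (zero)
  open Algebra.Properties.Ring ring using (-‿distribˡ-*; +-inverseˡ-unique)
  open Algebra.Solver.Ring.NaturalCoefficients.Default commutativeSemiring
  open Relation.Binary.Reasoning.Setoid setoid
  open ChainRing R m q μ finite chain local residue nil
  open Digits (proj₁ uniformizer) (proj₁ (proj₂ uniformizer)) (proj₂ (proj₂ uniformizer))

  m-isIdeal : IsIdeal R m
  m-isIdeal = proj₁ local

  N : ℕ
  N = q ^ suc μ + q ^ μ

  -- The class of 0 is one of the q residue classes, so q is positive.
  0<N : 0 < N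
  0<N = ≤-trans (m^n>0 q (suc μ)) (m≤m+n _ _)
    where instance q≢0 : NonZero q
                   q≢0 = nonZeroIndex (proj₁ (class 0#))

  -x*y+x*y≈0 : ∀ x y → (- x) ⊗ y ⊕ x ⊗ y ≈ 0#
  -x*y+x*y≈0 x y = trans (+-congʳ (sym (-‿distribˡ-* x y))) (-‿inverseˡ (x ⊗ y))

  m-cancel : ∀ {x u} → ¬ m u → m (x ⊗ u) → m x
  m-cancel {x} {u} u∉m xu∈m =
    let w , wu≈1 = inverse u∉m in
    m-resp (begin
      w ⊗ (x ⊗ u)  ≈⟨ solve 3 (λ w x u → w :* (x :* u) := x :* (w :* u)) refl w x u ⟩
      x ⊗ (w ⊗ u)  ≈⟨ *-congˡ wu≈1 ⟩
      x ⊗ 1#       ≈⟨ *-identityʳ x ⟩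
      x ∎) (m-* w xu∈m)

  m-+-cancelʳ : ∀ {x y} → m (x ⊕ y) → m y → m x
  m-+-cancelʳ {x} {y} x+y∈m y∈m = m-resp (begin
    (x ⊕ y) ⊖ y      ≈⟨ +-assoc x y (- y) ⟩
    x ⊕ (y ⊖ y)      ≈⟨ +-congˡ (-‿inverseʳ y) ⟩
    x ⊕ 0#           ≈⟨ +-identityʳ x ⟩
    x ∎) (m-+ x+y∈m (m-neg y∈m))

  -- Relations and spanning sets in a uniform representation

  module Uniform {a b} (V : Module R a b) {n} (v : Fin n → Module.Carrierᴹ V) {k}
                 (uniform : ∀ J → U k n J ⇔ MA R V m v J) where

    open Module V using (_≈ᴹ_; 0ᴹ; _*ₗ_; +ᴹ-cong; +ᴹ-identityʳ; ≈ᴹ-sym; ≈ᴹ-trans;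
      *ₗ-congˡ; *ₗ-congʳ; *ₗ-zeroˡ; *ₗ-zeroʳ; *ₗ-distribʳ)
    open Combinations V

    relation∈m : ∀ {J α} → ∣ J ∣ ≤ k → comb v α ≈ᴹ 0ᴹ → Supp α J → ∀ i → m (α i)
    relation∈m {J} ∣J∣≤k = independent⇒ v m m-isIdeal m? (Equivalence.to (uniform J) ∣J∣≤k)

    relation : ∀ J → k < ∣ J ∣ → ¬ ¬ (∃ λ α → comb v α ≈ᴹ 0ᴹ × Supp α J × ∃ λ i → i ∈ J × ¬ m (α i))
    relation J k<∣J∣ = dependent⇒ v m m-isIdeal m? (λ indep → <⇒≱ k<∣J∣ (Equivalence.from (uniform J) indep))

    Spanning : Subset n → Set (c ⊔ ℓ ⊔ b)
    Spanning S = ∀ i → ∃ λ β → comb v β ≈ᴹ v i × Supp β S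

    ⊤-spanning : Spanning ⊤
    ⊤-spanning i = δ i , comb-δ v i , λ j j∉⊤ → ⊥-elim (j∉⊤ ∈⊤)

    -- A multiple of the relation r is subtracted from each expression to clear its coefficient at
    -- i. This is possible because `r i` is a unit, and it leaves the value unchanged.
    exchange : ∀ {S r i} → comb v r ≈ᴹ 0ᴹ → Supp r S → ¬ m (r i) → Spanning S → Spanning (S - i)
    exchange {S} {r} {i} rel r⊆S rᵢ∉m spanning j =
      let u , urᵢ≈1   = inverse rᵢ∉m
          β , eq , β⊆S = spanning j
          d = - (β i ⊗ u)
          β′ = λ l → β l ⊕ d ⊗ r l
          value : comb v β′ ≈ᴹ v j
          value = ≈ᴹ-trans (comb-+ v β (λ l → d ⊗ r l)) (≈ᴹ-trans
                    (+ᴹ-cong eq (≈ᴹ-trans (comb-* v d r) (≈ᴹ-trans (*ₗ-congˡ rel) (*ₗ-zeroʳ d))))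
                    (+ᴹ-identityʳ (v j)))
          at-i : β i ⊕ d ⊗ r i ≈ 0#
          at-i = begin
            β i ⊕ d ⊗ r i                 ≈⟨ +-comm _ _ ⟩
            d ⊗ r i ⊕ β i                 ≈⟨ +-congˡ (trans (sym (*-identityʳ (β i))) (*-congˡ (sym urᵢ≈1))) ⟩
            d ⊗ r i ⊕ β i ⊗ (u ⊗ r i)     ≈⟨ +-congˡ (sym (*-assoc (β i) u (r i))) ⟩
            d ⊗ r i ⊕ (β i ⊗ u) ⊗ r i     ≈⟨ -x*y+x*y≈0 (β i ⊗ u) (r i) ⟩
            0# ∎
          support : Supp β′ (S - i)
          support l l∉ = case-l l l∉ (l ≟ i) β⊆S at-i
      in β′ , value , support
      where
      case-l : ∀ {β d} l → l ∉ S - i → Dec (l ≡ i) → Supp β S → β i ⊕ d ⊗ r i ≈ 0# → β l ⊕ d ⊗ r l ≈ 0#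
      case-l l l∉ (yes ≡.refl) β⊆S at-i = at-i
      case-l {d = d} l l∉ (no l≢i) β⊆S at-i =
        let l∉S = λ l∈S → l∉ (x∈p∧x≢y⇒x∈p-y l∈S l≢i)
        in trans (+-cong (β⊆S l l∉S) (trans (*-congˡ (r⊆S l l∉S)) (zeroʳ d))) (+-identityʳ 0#)

    -- More than k vectors satisfy a relation with a unit coefficient, so one of them can be
    -- discarded. The bound s decreases at each removal, and the double negation comes from
    -- `relation`.
    small-spanning : ∀ s S → ∣ S ∣ ≤ s → Spanning S → ¬ ¬ (∃ λ S′ → ∣ S′ ∣ ≤ k × Spanning S′)
    small-spanning zero    S ∣S∣≤0 spanning none = none (S , ≤-trans ∣S∣≤0 z≤n , spanning)
    small-spanning (suc s) S ∣S∣≤s spanning none with ∣ S ∣ ≤? k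
    ... | yes ∣S∣≤k = none (S , ∣S∣≤k , spanning)
    ... | no ∣S∣≰k = relation S (≰⇒> ∣S∣≰k) λ { (r , rel , r⊆S , i , i∈S , rᵢ∉m) →
      small-spanning s (S - i) (s≤s⁻¹ (≤-trans (x∈p⇒∣p-x∣<∣p∣ i∈S) ∣S∣≤s)) (exchange rel r⊆S rᵢ∉m spanning) none }

    -- Proportionality would give the relation v i - d v j = 0 on an independent pair, with
    -- coefficient 1 at i.
    distinct-nonproportional : 2 ≤ k → ∀ {i j} → i ≢ j → ∀ d → ¬ v i ≈ᴹ d *ₗ v j
    distinct-nonproportional 2≤k {i} {j} i≢j d vᵢ≈dvⱼ =
      1∉m (m-resp αᵢ≈1 (relation∈m {⁅ i ⁆ ∪ ⁅ j ⁆} {α} (≤-trans size 2≤k) rel support i))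
      where
      α = λ l → δ i l ⊕ - d ⊗ δ j l
      size : ∣ ⁅ i ⁆ ∪ ⁅ j ⁆ ∣ ≤ 2
      size = ≤-trans (∣p∪q∣≤∣p∣+∣q∣ ⁅ i ⁆ ⁅ j ⁆) (≤-reflexive (≡.cong₂ _+_ (∣⁅x⁆∣≡1 i) (∣⁅x⁆∣≡1 j)))
      αᵢ≈1 : α i ≈ 1#
      αᵢ≈1 = trans (+-cong (δ-same i) (trans (*-congˡ (δ-diff j i (λ j≡i → i≢j (≡.sym j≡i)))) (zeroʳ _))) (+-identityʳ 1#)
      rel : comb v α ≈ᴹ 0ᴹ
      rel = ≈ᴹ-trans (comb-+ v (δ i) (λ l → - d ⊗ δ j l)) (≈ᴹ-trans
        (+ᴹ-cong (≈ᴹ-trans (comb-δ v i) vᵢ≈dvⱼ) (comb-*δ v (- d) j)) (≈ᴹ-trans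
        (≈ᴹ-sym (*ₗ-distribʳ (v j) d (- d))) (≈ᴹ-trans (*ₗ-congʳ (-‿inverseʳ d)) (*ₗ-zeroˡ (v j)))))
      support : Supp α (⁅ i ⁆ ∪ ⁅ j ⁆)
      support l l∉ = trans (+-cong
          (δ-diff i l λ { ≡.refl → l∉ (x∈p∪q⁺ (inj₁ (x∈⁅x⁆ i))) })
          (trans (*-congˡ (δ-diff j l λ { ≡.refl → l∉ (x∈p∪q⁺ (inj₂ (x∈⁅x⁆ j))) })) (zeroʳ _)))
        (+-identityʳ 0#)

  -- The bound is a decidable inequality, so a spanning pair known only up to double negation is
  -- enough.
  rank-two-bound : ∀ {a b} n → Representable R m a b (U 2 n) → n ≤ N
  rank-two-bound zero _ = z≤n
  rank-two-bound (suc n) (V , v , iso) = decidable-stable (suc n ≤? N) λ n≰N →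
    small-spanning (suc n) ⊤ (∣p∣≤n ⊤) ⊤-spanning λ { (S , ∣S∣≤2 , spanning) →
      n≰N (bound S spanning (pair-containing S ∣S∣≤2)) }
    where
    open Uniform V v (uniform-iso {M = MA R V m v} iso)
    open Combinations V
    open Module V using (≈ᴹ-sym; ≈ᴹ-trans; *ₗ-congˡ)

    bound : ∀ S → Spanning S → (∃ λ i → ∃ λ j → ∀ k → k ∈ S → k ≡ i ⊎ k ≡ j) → suc n ≤ N
    bound S spanning (i , j , S⊆ij) = incomparable⇒bounded (λ l → β l i) (λ l → β l j)
      λ {k} {l} k≢l d eqᵢ eqⱼ → distinct-nonproportional ≤-refl k≢l d
        (≈ᴹ-trans (≈ᴹ-sym (comb-β k)) (≈ᴹ-trans (comb-cong v (agree eqᵢ eqⱼ))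
          (≈ᴹ-trans (comb-* v d (β l)) (*ₗ-congˡ (comb-β l)))))
      where
      β = λ l → proj₁ (spanning l)
      comb-β = λ l → proj₁ (proj₂ (spanning l))
      β⊆S = λ l → proj₂ (proj₂ (spanning l))

      -- Proportionality at i and j extends to all coefficients, since they vanish outside `S`;
      -- hence it passes to the vectors themselves.
      agree : ∀ {k l d} → β k i ≈ d ⊗ β l i → β k j ≈ d ⊗ β l j → ∀ s → β k s ≈ d ⊗ β l s
      agree {k} {l} {d} eqᵢ eqⱼ s with s ∈? S
      ... | no s∉S = trans (β⊆S k s s∉S) (sym (trans (*-congˡ (β⊆S l s s∉S)) (zeroʳ d)))
      ... | yes s∈S with S⊆ij s s∈S
      ...   | inj₁ ≡.refl = eqᵢ
      ...   | inj₂ ≡.refl = eqⱼ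

  -- One entry divides the other, so (-t, 1) or (1, -s) works; the coordinate 1 keeps it from being
  -- zero modulo `m`.
  orthogonal : ∀ x y → ∃ λ α → ∃ λ β → α ⊗ x ⊕ β ⊗ y ≈ 0# × ¬ (m α × m β)
  orthogonal x y with ∣-total x y
  ... | inj₁ (t , y≈tx) = - t , 1# ,
          trans (+-congˡ (trans (*-identityˡ y) y≈tx)) (-x*y+x*y≈0 t x) , λ mαβ → 1∉m (proj₂ mαβ)
  ... | inj₂ (s , x≈sy) = 1# , - s ,
          trans (+-comm _ _) (trans (+-congˡ (trans (*-identityˡ x) x≈sy)) (-x*y+x*y≈0 s y)) , λ mαβ → 1∉m (proj₁ mαβ)

  corank-two-bound : ∀ {a b} → ¬ Representable R m a b (U (N ∸ 1) (suc N))
  corank-two-bound (V , v , iso) =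
    relation ⊤ (≤-trans (s≤s (N∸1≤N)) (≤-reflexive (≡.sym (∣⊤∣≡n (suc N))))) λ { (r , r-rel , _ , i , _ , rᵢ∉m) →
    -- Without i there remain N vectors, still more than the rank N - 1. The second relation
    -- vanishes at i, so r and s are triangular at i, j with unit diagonal.
    relation (⊤ - i) (N∸1<∣⊤-i∣ i) λ { (s , s-rel , s⊆ , j , _ , sⱼ∉m) →
    1+n≰n (incomparable⇒bounded r s (incomparable r-rel rᵢ∉m s-rel (s⊆ i (x∉p-x ⊤ i)) sⱼ∉m)) } }
    where
    open Uniform V v (uniform-iso {M = MA R V m v} iso)
    open Combinations V
    open Module V using (_≈ᴹ_; 0ᴹ; +ᴹ-cong; +ᴹ-identityʳ; ≈ᴹ-sym; ≈ᴹ-trans; *ₗ-congˡ; *ₗ-zeroʳ)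

    N∸1≤N : N ∸ 1 ≤ N
    N∸1≤N = m∸n≤m N 1

    N∸1<N : N ∸ 1 < N
    N∸1<N = ≤-reflexive (m+[n∸m]≡n 0<N)

    N∸1<∣⊤-i∣ : ∀ i → N ∸ 1 < ∣ ⊤ {suc N} - i ∣
    N∸1<∣⊤-i∣ i = ≤-trans N∸1<N (s≤s⁻¹ (≤-trans (≤-reflexive (≡.sym (∣⊤∣≡n (suc N)))) (∣p∣≤1+∣p-x∣ ⊤ i)))

    ∣⊤-k-l∣≤ : ∀ {k l} → k ≢ l → ∣ ⊤ {suc N} - k - l ∣ ≤ N ∸ 1
    ∣⊤-k-l∣≤ {k} {l} k≢l = ∸-monoˡ-≤ 1 (s≤s⁻¹ (≤-trans
      (s≤s (x∈p⇒∣p-x∣<∣p∣ {p = ⊤ - k} (x∈p∧x≢y⇒x∈p-y ∈⊤ (λ l≡k → k≢l (≡.sym l≡k)))))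
      (≤-trans (x∈p⇒∣p-x∣<∣p∣ {x = k} {p = ⊤} ∈⊤) (≤-reflexive (∣⊤∣≡n (suc N))))))

    -- If the columns k and l of (r , s) were proportional, a vector orthogonal to both would
    -- produce a relation among the other N - 1 vectors with a unit coefficient.
    incomparable : ∀ {r s i j} → comb v r ≈ᴹ 0ᴹ → ¬ m (r i) → comb v s ≈ᴹ 0ᴹ → s i ≈ 0# → ¬ m (s j) →
      ∀ {k l} → k ≢ l → ∀ d → r k ≈ d ⊗ r l → s k ≈ d ⊗ s l → ⊥
    incomparable {r} {s} {i} {j} r-rel rᵢ∉m s-rel sᵢ≈0 sⱼ∉m {k} {l} k≢l d eqr eqs =
      let α , β , ortho , unimodular = orthogonal (r l) (s l)
          γ = λ h → α ⊗ r h ⊕ β ⊗ s h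
          γ-rel : comb v γ ≈ᴹ 0ᴹ
          γ-rel = ≈ᴹ-trans (comb-+ v (λ h → α ⊗ r h) (λ h → β ⊗ s h)) (≈ᴹ-trans
            (+ᴹ-cong (≈ᴹ-trans (comb-* v α r) (≈ᴹ-trans (*ₗ-congˡ r-rel) (*ₗ-zeroʳ α)))
                     (≈ᴹ-trans (comb-* v β s) (≈ᴹ-trans (*ₗ-congˡ s-rel) (*ₗ-zeroʳ β)))) (+ᴹ-identityʳ 0ᴹ))
          γ∈m = relation∈m {⊤ - k - l} {γ} (∣⊤-k-l∣≤ k≢l) γ-rel (support ortho)
          -- At i only α (r i) survives, which puts α into `m`; subtracting α (r j) at j then does
          -- the same for β.
          α∈m = m-cancel rᵢ∉m (m-resp (trans (+-congˡ (trans (*-congˡ sᵢ≈0) (zeroʳ β))) (+-identityʳ _)) (γ∈m i))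
          β∈m = m-cancel sⱼ∉m (m-+-cancelʳ (m-resp (+-comm _ _) (γ∈m j)) (m-resp (*-comm _ _) (m-* (r j) α∈m)))
      in unimodular (α∈m , β∈m)
      where
      support : ∀ {α β} → α ⊗ r l ⊕ β ⊗ s l ≈ 0# → Supp (λ h → α ⊗ r h ⊕ β ⊗ s h) (⊤ - k - l)
      support {α} {β} ortho h h∉ with h ≟ k | h ≟ l
      ... | _ | yes ≡.refl = ortho
      ... | yes ≡.refl | no _ = begin
        α ⊗ r k ⊕ β ⊗ s k               ≈⟨ +-cong (*-congˡ eqr) (*-congˡ eqs) ⟩
        α ⊗ (d ⊗ r l) ⊕ β ⊗ (d ⊗ s l)   ≈⟨ solve 5 (λ a b d x y →
            a :* (d :* x) :+ b :* (d :* y) := d :* (a :* x :+ b :* y)) refl α β d (r l) (s l) ⟩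
        d ⊗ (α ⊗ r l ⊕ β ⊗ s l)         ≈⟨ *-congˡ ortho ⟩
        d ⊗ 0#                          ≈⟨ zeroʳ d ⟩
        0# ∎
      ... | no h≢k | no h≢l = ⊥-elim (h∉ (x∈p∧x≢y⇒x∈p-y (x∈p∧x≢y⇒x∈p-y ∈⊤ h≢k) h≢l))

  -- The zero module only raises the universe levels.
  R² : ∀ a b → Module R (c ⊔ a) (ℓ ⊔ b)
  R² a b = Product.⟨module⟩ (Zero.⟨module⟩ {a} {b}) (Product.⟨module⟩ TensorUnit.⟨module⟩ TensorUnit.⟨module⟩)

  -- Modular independence of vectors in R²

  module Plane {a b : Level} {n : ℕ} (x y : Fin n → Carrier) where

    V = R² a b
    open Module V using (_≈ᴹ_; 0ᴹ; _*ₗ_; _+ᴹ_; +ᴹ-cong; ≈ᴹ-trans; ≈ᴹ-sym)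
    open Combinations V

    v : Fin n → Module.Carrierᴹ V
    v i = _ , x i , y i

    -- Subtracting multiples of v i clears the first coordinates of v j and v k. The hypothesis on y
    -- then says v j - d v i = f (v k - e v i), a relation with coefficient 1 at j.
    elimination : ∀ {I i j k} → ModIndep R V m v I → (i ∈ I × j ∈ I × k ∈ I) → j ≢ i → k ≢ j →
      ∀ {d e f} → x j ≈ d ⊗ x i → x k ≈ e ⊗ x i → y j ⊕ - d ⊗ y i ≈ f ⊗ (y k ⊕ - e ⊗ y i) → ⊥
    elimination {I} {i} {j} {k} indep (i∈I , j∈I , k∈I) j≢i k≢j {d} {e} {f} xⱼ≈ xₖ≈ yⱼ≈ =
      1∉m (m-resp γⱼ≈1 (independent⇒ v m m-isIdeal m? {I} {γ} indep rel support j))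
      where
      g = - d ⊕ - f ⊗ - e
      γ = λ l → (g ⊗ δ i l ⊕ - f ⊗ δ k l) ⊕ δ j l

      zeros : ∀ {s t u} → s ≈ 0# → t ≈ 0# → (g ⊗ s ⊕ - f ⊗ t) ⊕ u ≈ u
      zeros s≈0 t≈0 = trans
        (+-congʳ (trans (+-cong (trans (*-congˡ s≈0) (zeroʳ g)) (trans (*-congˡ t≈0) (zeroʳ _))) (+-identityˡ 0#))) (+-identityˡ _)

      γⱼ≈1 : γ j ≈ 1#
      γⱼ≈1 = trans (zeros (δ-diff i j (λ i≡j → j≢i (≡.sym i≡j))) (δ-diff k j k≢j)) (δ-same j)

      support : Supp γ I
      support l l∉I = trans (zeros (δ-diff i l λ { ≡.refl → l∉I i∈I }) (δ-diff k l λ { ≡.refl → l∉I k∈I }))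
        (δ-diff j l λ { ≡.refl → l∉I j∈I })

      -- The negatives of d, e, f enter as variables, which makes this an identity of commutative
      -- semirings.
      rearrange : ∀ D E F zᵢ zⱼ zₖ → ((D ⊕ F ⊗ E) ⊗ zᵢ ⊕ F ⊗ zₖ) ⊕ zⱼ ≈ F ⊗ (zₖ ⊕ E ⊗ zᵢ) ⊕ (zⱼ ⊕ D ⊗ zᵢ)
      rearrange = solve 6 (λ D E F zi zj zk →
        ((D :+ F :* E) :* zi :+ F :* zk) :+ zj := F :* (zk :+ E :* zi) :+ (zj :+ D :* zi)) refl

      cleared : ∀ {z w d} → z ≈ d ⊗ w → z ⊕ - d ⊗ w ≈ 0#
      cleared {d = d} z≈dw = trans (+-congʳ z≈dw) (trans (+-comm _ _) (-x*y+x*y≈0 d _))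

      x-eq : (g ⊗ x i ⊕ - f ⊗ x k) ⊕ x j ≈ 0#
      x-eq = trans (rearrange _ _ _ _ _ _)
        (trans (+-cong (trans (*-congˡ (cleared xₖ≈)) (zeroʳ _)) (cleared xⱼ≈)) (+-identityʳ 0#))

      y-eq : (g ⊗ y i ⊕ - f ⊗ y k) ⊕ y j ≈ 0#
      y-eq = trans (rearrange _ _ _ _ _ _) (trans (+-congˡ yⱼ≈) (-x*y+x*y≈0 f _))

      rel : comb v γ ≈ᴹ 0ᴹ
      rel = ≈ᴹ-trans (comb-+ v (λ l → g ⊗ δ i l ⊕ - f ⊗ δ k l) (δ j)) (≈ᴹ-trans
        (+ᴹ-cong (≈ᴹ-trans (comb-+ v (λ l → g ⊗ δ i l) (λ l → - f ⊗ δ k l))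
                         (+ᴹ-cong (comb-*δ v g i) (comb-*δ v (- f) k))) (comb-δ v j))
        (_ , x-eq , y-eq))

    -- After clearing with v i, one remaining second coordinate divides the other; the two cases
    -- exchange the roles of j and k.
    pivot : ∀ {I i j k} → ModIndep R V m v I → (i ∈ I × j ∈ I × k ∈ I) → j ≢ i → k ≢ i → k ≢ j →
      ⟨ x i ⟩ (x j) → ⟨ x i ⟩ (x k) → ⊥
    pivot {i = i} {j} {k} indep (i∈I , j∈I , k∈I) j≢i k≢i k≢j (d , xⱼ≈) (e , xₖ≈)
      with ∣-total (y k ⊕ - e ⊗ y i) (y j ⊕ - d ⊗ y i)
    ... | inj₁ (f , eq) = elimination indep (i∈I , j∈I , k∈I) j≢i k≢j xⱼ≈ xₖ≈ eq
    ... | inj₂ (f , eq) = elimination indep (i∈I , k∈I , j∈I) k≢i (λ j≡k → k≢j (≡.sym j≡k)) xₖ≈ xⱼ≈ eq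

    -- Among three members, one has a first coordinate dividing the other two, and that vector
    -- serves as pivot.
    independent⇒∣I∣≤2 : ∀ I → ModIndep R V m v I → ∣ I ∣ ≤ 2
    independent⇒∣I∣≤2 I indep = ≮⇒≥ λ 2<∣I∣ →
      let i , j , k , (i∈I , j∈I , k∈I) , j≢i , k≢i , k≢j = three-members I 2<∣I∣
          i≢j = λ i≡j → j≢i (≡.sym i≡j)
          i≢k = λ i≡k → k≢i (≡.sym i≡k)
          j≢k = λ j≡k → k≢j (≡.sym j≡k)
          smallest-is-i = pivot indep (i∈I , j∈I , k∈I) j≢i k≢i k≢j
          smallest-is-j = pivot indep (j∈I , i∈I , k∈I) i≢j k≢j k≢i
          smallest-is-k = pivot indep (k∈I , i∈I , j∈I) i≢k j≢k j≢i
      in minimum smallest-is-i smallest-is-j smallest-is-k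
      where
      minimum : ∀ {p q r} → (⟨ p ⟩ q → ⟨ p ⟩ r → ⊥) → (⟨ q ⟩ p → ⟨ q ⟩ r → ⊥) → (⟨ r ⟩ p → ⟨ r ⟩ q → ⊥) → ⊥
      minimum {p} {q} {r} no-p no-q no-r with ∣-total p q | ∣-total p r | ∣-total q r
      ... | inj₁ p∣q | inj₁ p∣r | _        = no-p p∣q p∣r
      ... | inj₁ p∣q | inj₂ r∣p | _        = no-r r∣p (∣-trans r∣p p∣q)
      ... | inj₂ q∣p | _        | inj₁ q∣r = no-q q∣p q∣r
      ... | inj₂ q∣p | _        | inj₂ r∣q = no-r (∣-trans r∣q q∣p) r∣q

    module _ (nonzero : ∀ i → ¬ (x i ≈ 0# × y i ≈ 0#))
             (nonproportional : ∀ {i j} d → x i ≈ d ⊗ x j → y i ≈ d ⊗ y j → i ≡ j) where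

      solve-for : ∀ {β γ z w} → β ⊗ z ⊕ γ ⊗ w ≈ 0# → ∀ {u} → u ⊗ β ≈ 1# → z ≈ - (u ⊗ γ) ⊗ w
      solve-for {β} {γ} {z} {w} eq {u} uβ≈1 = trans (+-inverseˡ-unique z (u ⊗ γ ⊗ w) (begin
        z ⊕ u ⊗ γ ⊗ w              ≈⟨ +-congʳ (trans (sym (*-identityˡ z)) (*-congʳ (sym uβ≈1))) ⟩
        u ⊗ β ⊗ z ⊕ u ⊗ γ ⊗ w      ≈⟨ solve 5 (λ u b z g w →
            u :* b :* z :+ u :* g :* w := u :* (b :* z :+ g :* w)) refl u β z γ w ⟩
        u ⊗ (β ⊗ z ⊕ γ ⊗ w)        ≈⟨ *-congˡ eq ⟩
        u ⊗ 0#                     ≈⟨ zeroʳ u ⟩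
        0# ∎)) (-‿distribˡ-* (u ⊗ γ) w)

      -- A unit coefficient at i would make v i zero or a multiple of the only other vector, and
      -- both are excluded.
      ∣I∣≤2⇒independent : ∀ I → ∣ I ∣ ≤ 2 → ModIndep R V m v I
      ∣I∣≤2⇒independent I ∣I∣≤2 α α-rel i i∈I = decidable-stable (m? (α i)) λ αᵢ∉m →
        dependent (λ βᵢ∈m → αᵢ∉m (≡.subst m (mask-on I α i∈I) βᵢ∈m)) (∣p∣≤2⇒pair I ∣I∣≤2 i∈I)
        where
        β = mask I α

        β-rel : comb v β ≈ᴹ 0ᴹ
        β-rel = ≈ᴹ-trans (≈ᴹ-sym (comb-mask v I α)) α-rel

        dependent : ¬ m (β i) → (∃ λ j → ∀ k → k ∈ I → k ≡ i ⊎ k ≡ j) → ⊥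
        dependent βᵢ∉m (j , I⊆ij) with j ≟ i
        -- The degenerate pair: `I` contains only i, so a unit multiple of v i vanishes.
        ... | yes ≡.refl = nonzero i (vanishes (proj₁ (proj₂ scaled)) , vanishes (proj₂ (proj₂ scaled)))
          where
          only-i : ∀ k → β i ⊗ δ i k ≈ β k
          only-i k with i ≟ k
          ... | yes ≡.refl = *-identityʳ _
          ... | no i≢k = trans (zeroʳ _) (sym (mask-supp I α k (λ k∈I → i≢k (≡.sym (reduce (I⊆ij k k∈I))))))
          scaled : β i *ₗ v i ≈ᴹ 0ᴹ
          scaled = ≈ᴹ-trans (≈ᴹ-sym (comb-*δ v (β i) i)) (≈ᴹ-trans (comb-cong v only-i) β-rel)
          vanishes : ∀ {z} → β i ⊗ z ≈ 0# → z ≈ 0#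
          vanishes eq = unit-cancels βᵢ∉m (trans (*-comm _ _) eq)
        ... | no j≢i = j≢i (≡.sym (nonproportional (- (u ⊗ β j))
              (solve-for (proj₁ (proj₂ pair-sum)) uβᵢ≈1) (solve-for (proj₂ (proj₂ pair-sum)) uβᵢ≈1)))
          where
          u = proj₁ (inverse βᵢ∉m)
          uβᵢ≈1 = proj₂ (inverse βᵢ∉m)
          only-ij : ∀ k → β i ⊗ δ i k ⊕ β j ⊗ δ j k ≈ β k
          only-ij k with k ≟ i | k ≟ j
          ... | yes ≡.refl | _ = trans (+-cong (trans (*-congˡ (δ-same i)) (*-identityʳ _))
                  (trans (*-congˡ (δ-diff j i j≢i)) (zeroʳ _))) (+-identityʳ _)
          ... | no k≢i | yes ≡.refl = trans (+-cong (trans (*-congˡ (δ-diff i j (k≢i ∘ ≡.sym))) (zeroʳ _))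
                  (trans (*-congˡ (δ-same j)) (*-identityʳ _))) (+-identityˡ _)
          ... | no k≢i | no k≢j = trans (+-cong (trans (*-congˡ (δ-diff i k (k≢i ∘ ≡.sym))) (zeroʳ _))
                  (trans (*-congˡ (δ-diff j k (k≢j ∘ ≡.sym))) (zeroʳ _))) (trans (+-identityˡ 0#)
                  (sym (mask-supp I α k λ k∈I → [ k≢i , k≢j ]′ (I⊆ij k k∈I))))
          pair-sum : β i *ₗ v i +ᴹ β j *ₗ v j ≈ᴹ 0ᴹ
          pair-sum = ≈ᴹ-trans
                  (≈ᴹ-sym (≈ᴹ-trans (comb-+ v (λ k → β i ⊗ δ i k) (λ k → β j ⊗ δ j k))
                                    (+ᴹ-cong (comb-*δ v (β i) i) (comb-*δ v (β j) j))))
                  (≈ᴹ-trans (comb-cong v only-ij) β-rel)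

  U₂-representable : ∀ a b {n} → n ≤ N → Representable R m (c ⊔ a) (ℓ ⊔ b) (U 2 n)
  U₂-representable a b {n} n≤N = V , v , ↔-refl , λ I →
    -- The image of `I` under the identity permutation is a tabulated copy of `I`, equal to it only
    -- propositionally.
    ≡.subst (λ J → U 2 n I ⇔ ModIndep R V m v J) (≡.sym (tabulate∘lookup I))
      (mk⇔ (∣I∣≤2⇒independent (λ i → coords-nonzero (splitAt _ (inject≤ i n≤N)))
             (λ {i} {j} d eqx eqy → inject≤-injective n≤N n≤N i j
               (point-injective (inject≤ i n≤N) (inject≤ j n≤N) d eqx eqy)) I)
           (independent⇒∣I∣≤2 I))
    where
    open Plane {a} {b} {n} (λ i → proj₁ (point (inject≤ i n≤N))) (λ i → proj₂ (point (inject≤ i n≤N)))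

-- The zeroth power of `m` contains the empty product 1, so its vanishing would put 1 into `m`. This
-- leaves ν = μ + 1, where ν - 1 is not truncated.
NilIndex⇒≢0 : ∀ {c ℓ} (R : CommutativeRing c ℓ) {m} → IsLocalWith R m → ¬ NilIndex R m 0
NilIndex⇒≢0 R (m-isIdeal , proper , _) (zero-ideal , _) =
  proper (IsIdeal.resp m-isIdeal (sym 1≈0) (IsIdeal.zero∈ m-isIdeal))
  where
  open CommutativeRing R
  1≈0 : 1# ≈ 0#
  1≈0 = zero-ideal 1# (1 , (λ _ → 1#) , (λ _ → (λ ()) , (λ ()) , refl) , sym (+-identityʳ 1#))

theorem5p5 : ∀ {c ℓ} (a b : Level) (R : CommutativeRing c ℓ) (m : PredR R) (q ν : ℕ) →
    IsFinite R → IsChainRing R → IsLocalWith R m →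
    ResidueCard R m q → NilIndex R m ν →
    (∀ (n : ℕ) →
    Representable R m a b (U 2 n) → n ≤ q ^ ν + q ^ (ν ∸ 1))
    × (∀ (n : ℕ) → n ≤ q ^ ν + q ^ (ν ∸ 1) →
    Representable R m (c ⊔ a) (ℓ ⊔ b) (U 2 n))
    × (¬ Representable R m a b (U 2 (suc (q ^ ν + q ^ (ν ∸ 1)))))
    × (¬ Representable R m a b
    (U (q ^ ν + q ^ (ν ∸ 1) ∸ 1) (suc (q ^ ν + q ^ (ν ∸ 1)))))
theorem5p5 a b R m q zero    finite chain local residue nil = ⊥-elim (NilIndex⇒≢0 R local nil)
theorem5p5 a b R m q (suc μ) finite chain local residue nil =
  rank-two-bound , (λ n → U₂-representable a b) , (λ rep → 1+n≰n (rank-two-bound _ rep)) , corank-two-bound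
  where open Representations R m q μ finite chain local residue nil
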